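{- Let $\mathcal L$ be one of $\mathrm{FO}(<)$, $\mathrm{FO}(<,\equiv)$ or $\mathrm{FO}(\mathrm{RPR})$. Let $\boldsymbol q=(\mathcal O,\psi(\boldsymbol t))$ be an epistemic temporal ontology-mediated query (EOMQ). If all constituent OMPIQs of $\boldsymbol q$ (i.e. all pairs $(\mathcal O,\varkappa)$ such that an atom of the form $\varkappa(t)$ occurs in $\psi$) are $\mathcal L$-rewritable, then $\boldsymbol q$ is $\mathcal L$-rewritable.
   Context: Fix a countably infinite set of atomic concepts $A_i$. Positive temporal concepts are given by $\varkappa::=\top\mid A_i\mid\varkappa_1\land\varkappa_2\mid\varkappa_1\lor\varkappa_2\mid\bigcirc_F\varkappa\mid\Diamond_F\varkappa\mid\Box_F\varkappa\mid\varkappa_1\,\mathcal U\,\varkappa_2\mid\bigcirc_P\varkappa\mid\Diamond_P\varkappa\mid\Box_P\varkappa\mid\varkappa_1\,\mathcal S\,\varkappa_2$. An interpretation $\mathfrak M$ assigns to each atomic concept $A$ a set $A^{\mathfrak M}\subseteq\mathbb Z$; extensions: $\top^{\mathfrak M}=\mathbb Z$, $\land,\lor$ are $\cap,\cup$, $(\bigcirc_F\varkappa)^{\mathfrak M}=\{n\mid n+1\in\varkappa^{\mathfrak M}\}$, $(\Box_F\varkappa)^{\mathfrak M}=\{n\mid k\in\varkappa^{\mathfrak M}\ \forall k>n\}$, $(\Diamond_F\varkappa)^{\mathfrak M}=\{n\mid\exists k>n,\ k\in\varkappa^{\mathfrak M}\}$, $(\varkappa_1\,\mathcal U\,\varkappa_2)^{\mathfrak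 M}=\{n\mid\exists k>n,\ k\in\varkappa_2^{\mathfrak M}\text{ and }m\in\varkappa_1^{\mathfrak M}\text{ for all }n<m<k\}$, and symmetrically for the past operators. An ontology $\mathcal O$ is a finite set of clauses $C_1\land\dots\land C_k\to C_{k+1}\lor\dots\lor C_{k+m}$, $k,m\ge0$, where each $C_i$ is an atomic concept prefixed by a sequence of operators from $\Box_F,\Box_P,\bigcirc_F,\bigcirc_P$; a clause is true in $\mathfrak M$ if $\bigcap_{i\le k}C_i^{\mathfrak M}\subseteq\bigcup_{j=1}^{m}C_{k+j}^{\mathfrak M}$ (empty $\bigcap$ is $\mathbb Z$, empty $\bigcup$ is $\emptyset$). A data instance $\mathcal A$ is a finite set of ground atoms $A_i(\ell)$, $\ell\in\mathbb Z$; it is assumed throughout that the least integer $\min\mathcal A$ occurring in it is $0$ and the greatest one satisfies $\max\mathcal A\ge1$; $\mathrm{tem}(\mathcal A)=\{n\in\mathbb Z\mid\min\mathcal A\le n\le\max\mathcal A\}$. $\mathfrak M$ is a model of $(\mathcal O,\mathcal A)$ if all clauses of $\mathcal O$ are true in $\mathfrak M$ and $\ell\in A^{\mathfrak M}$ for all $A(\ell)\in\mathcal A$. An OMPIQ is a pair $(\mathcal O,\varkappa)$ with $\varkappa$ a positive temporal concept; $\mathrm{ans}(\mathcal O,\varkappa,\mathcal A)=\{\ell\in\mathrm{tem}(\mathcal A)\mid\ell\in\varkappa^{\mathfrak M}\text{ for every model }\mathfrak M\text{ of }(\mathcal O,\mathcal A)\}$. An EOMQ is a pair $\boldsymbol q=(\mathcal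 O,\psi(\boldsymbol t))$, where $\psi(\boldsymbol t)$ is a first-order formula with free variables $\boldsymbol t$ built from atoms $\varkappa(t)$, $(t<t')$ and the abbreviations $(t=t')$, $(t=t'+1)$, with $\varkappa$ positive temporal concepts. It is evaluated over the structure $\mathfrak G_{\mathcal O,\mathcal A}$ with domain $\mathrm{tem}(\mathcal A)$: under an assignment $\mathfrak a$ of variables to elements of $\mathrm{tem}(\mathcal A)$, $\varkappa(t)$ is true iff $\mathfrak a(t)\in\mathrm{ans}(\mathcal O,\varkappa,\mathcal A)$, $t<t'$ is true iff $\mathfrak a(t)<\mathfrak a(t')$, with the standard clauses for Boolean connectives and for first-order quantifiers ranging over $\mathrm{tem}(\mathcal A)$. A tuple $\boldsymbol\ell$ in $\mathrm{tem}(\mathcal A)$ is an answer to $\boldsymbol q$ over $\mathcal A$ if $\mathfrak G_{\mathcal O,\mathcal A}\models\psi(\boldsymbol\ell)$. $\mathfrak S_{\mathcal A}$ is the finite first-order structure with domain $\mathrm{tem}(\mathcal A)$ ordered by $<$ in which $A(\ell)$ holds iff $A(\ell)\in\mathcal A$. An OMPIQ $(\mathcal O,\varkappa)$ is $\mathcal L$-rewritable if there is a constant-free $\mathcal L$-formula $\boldsymbol Q(t)$ such that $\mathrm{ans}(\mathcal O,\varkappa,\mathcal A)=\{\ell\in\mathrm{tem}(\mathcal A)\mid\mathfrak S_{\mathcal A}\models\boldsymbol Q(\ell)\}$ for every data instance $\mathcal A$. An EOMQ $\boldsymbol q$ is $\mathcal L$-rewritable if there is an $\mathcal L$-formula $\boldsymbol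 Q(\boldsymbol t)$ such that, for every data instance $\mathcal A$ and every tuple $\boldsymbol\ell$ in $\mathrm{tem}(\mathcal A)$, $\boldsymbol\ell$ is an answer to $\boldsymbol q$ over $\mathcal A$ iff $\mathfrak S_{\mathcal A}\models\boldsymbol Q(\boldsymbol\ell)$. $\mathrm{FO}(<)$ is first-order logic over the unary predicates for atomic concepts and $<$. $\mathrm{FO}(<,\equiv)$ additionally has unary predicates $t\equiv0\pmod n$, for each fixed $n>1$, true of $\ell$ iff $n$ divides $\ell$. $\mathrm{FO}(\mathrm{RPR})$ extends first-order logic over the unary predicates and the successor relation with relational primitive recursion (in which $<$ is definable): if $\Theta_1,\dots,\Theta_n,\Psi$ are $\mathrm{FO}(\mathrm{RPR})$-formulas, one may form $\big[Q_i(\boldsymbol z_i,t)\equiv\Theta_i(\boldsymbol z_i,t,Q_1(\boldsymbol z_1,t-1),\dots,Q_n(\boldsymbol z_n,t-1)),\ 1\le i\le n\big]\ \Psi(\boldsymbol z,\boldsymbol z_1,\dots,\boldsymbol z_n)$, where the bracketed part defines the relations $Q_i$ used in $\Psi$ by recursion on $t=0,1,2,\dots$ in $\mathrm{tem}(\mathcal A)$, with all $Q_i(\boldsymbol z_i,-1)$ taken to be false; each relation variable $Q_i$ occurs in only one recursive definition. -}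

module Defs where

open import Data.Empty using (⊥)
open import Data.Fin.Base using (Fin)
open import Data.Integer.Base using (ℤ; 0ℤ; 1ℤ; +_; _+_; _-_; _≤_; _<_; +≤+)
open import Data.Integer.Divisibility using (_∣_)
import Data.Integer.Properties as ℤ
open import Data.List.Base using (List; []; _∷_; _++_; map; foldr)
open import Data.List.Membership.Propositional using (_∈_)
open import Data.List.Relation.Unary.All as All using (All; [])
import Data.List.Relation.Unary.All.Properties as All
open import Data.List.Relation.Unary.Any using (Any)
open import Data.Nat.Base as ℕ using (ℕ; z≤n)
import Data.Nat.Properties as ℕ
open import Data.Product.Base using (∃; ∃-syntax; _×_; _,_; proj₁; proj₂)
open import Data.Sum.Base using (_⊎_)
open import Data.Unit.Base using (⊤)
open import Data.Vec.Base as Vec using (Vec; []; _∷_; lookup)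
open import Function.Bundles using (_⇔_)
open import Level using (0ℓ)
open import Relation.Binary.PropositionalEquality using (_≡_)
open import Relation.Nullary using (¬_)
open import Relation.Unary using (Pred)

infixr 7 _∧_
infixr 6 _∨_
infixr 5 _⇒_

AtomicConcept : Set
AtomicConcept = ℕ

data Concept : Set where
  top                 : Concept
  atom                : AtomicConcept → Concept
  _∧_ _∨_             : Concept → Concept → Concept
  ○F ◇F □F ○P ◇P □P   : Concept → Concept
  _𝒰_ _𝒮_             : Concept → Concept → Concept

Interpretation : Set₁
Interpretation = AtomicConcept → Pred ℤ 0ℓ

infix 4 _⊩_∋_

-- 𝔐 ⊩ ϰ ∋ n  means  n ∈ ϰ^𝔐.
_⊩_∋_ : Interpretation → Concept → Pred ℤ 0ℓ
𝔐 ⊩ top     ∋ n = ⊤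
𝔐 ⊩ atom A  ∋ n = 𝔐 A n
𝔐 ⊩ ϰ ∧ χ   ∋ n = (𝔐 ⊩ ϰ ∋ n) × (𝔐 ⊩ χ ∋ n)
𝔐 ⊩ ϰ ∨ χ   ∋ n = (𝔐 ⊩ ϰ ∋ n) ⊎ (𝔐 ⊩ χ ∋ n)
𝔐 ⊩ ○F ϰ    ∋ n = 𝔐 ⊩ ϰ ∋ n + 1ℤ
𝔐 ⊩ ◇F ϰ    ∋ n = ∃[ k ] n < k × (𝔐 ⊩ ϰ ∋ k)
𝔐 ⊩ □F ϰ    ∋ n = ∀ k → n < k → 𝔐 ⊩ ϰ ∋ k
𝔐 ⊩ ϰ 𝒰 χ   ∋ n = ∃[ k ] n < k × (𝔐 ⊩ χ ∋ k) ×
                    (∀ m → n < m → m < k → 𝔐 ⊩ ϰ ∋ m)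
𝔐 ⊩ ○P ϰ    ∋ n = 𝔐 ⊩ ϰ ∋ n - 1ℤ
𝔐 ⊩ ◇P ϰ    ∋ n = ∃[ k ] k < n × (𝔐 ⊩ ϰ ∋ k)
𝔐 ⊩ □P ϰ    ∋ n = ∀ k → k < n → 𝔐 ⊩ ϰ ∋ k
𝔐 ⊩ ϰ 𝒮 χ   ∋ n = ∃[ k ] k < n × (𝔐 ⊩ χ ∋ k) ×
                    (∀ m → k < m → m < n → 𝔐 ⊩ ϰ ∋ m)

data Prefix : Set where
  ○F □F ○P □P : Prefix

record TemporalAtom : Set where
  constructor _·_
  field
    prefixes : List Prefix
    concept  : AtomicConcept

prefix : Prefix → Concept → Concept
prefix ○F = ○F
prefix □F = □F
prefix ○P = ○P
prefix □P = □P

toConcept : TemporalAtom → Concept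
toConcept (ps · A) = foldr prefix (atom A) ps

record Clause : Set where
  constructor _⟶_
  field
    body : List TemporalAtom
    head : List TemporalAtom

Ontology : Set
Ontology = List Clause

TrueIn : Interpretation → Clause → Set
TrueIn 𝔐 (body ⟶ head) =
  ∀ n → All (λ C → 𝔐 ⊩ toConcept C ∋ n) body → Any (λ C → 𝔐 ⊩ toConcept C ∋ n) head

record DataInstance : Set where
  field
    atoms : List (AtomicConcept × ℤ)

  timestamps : List ℤ
  timestamps = map proj₂ atoms

  field
    max        : ℤ
    0-occurs   : 0ℤ ∈ timestamps
    0-least    : All (0ℤ ≤_) timestamps
    max-occurs : max ∈ timestamps
    max-most   : All (_≤ max) timestamps
    1≤max      : 1ℤ ≤ max

open DataInstance using (atoms; max)

record Model (𝒪 : Ontology) (𝒜 : DataInstance) (𝔐 : Interpretation) : Set where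
  field
    ontology : All (TrueIn 𝔐) 𝒪
    facts    : All (λ (A , ℓ) → 𝔐 A ℓ) (atoms 𝒜)

tem : DataInstance → Set
tem 𝒜 = ∃[ ℓ ] 0ℤ ≤ ℓ × ℓ ≤ max 𝒜

record OMPIQ : Set where
  constructor _,_
  field
    ontology : Ontology
    concept  : Concept

ans : OMPIQ → (𝒜 : DataInstance) → Pred (tem 𝒜) _
ans (𝒪 , ϰ) 𝒜 (ℓ , _) = ∀ 𝔐 → Model 𝒪 𝒜 𝔐 → 𝔐 ⊩ ϰ ∋ ℓ

-- First-order formulas over the atoms ϰ(t) and t < t', with de Bruijn
-- variables; t = t' and t = t' + 1 are abbreviations definable from _≺_.
data EFormula (n : ℕ) : Set where
  _⟨_⟩     : Concept → Fin n → EFormula n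
  _≺_      : Fin n → Fin n → EFormula n
  ∼_       : EFormula n → EFormula n
  _∧_ _∨_  : EFormula n → EFormula n → EFormula n
  _⇒_      : EFormula n → EFormula n → EFormula n
  all′ ex′ : EFormula (ℕ.suc n) → EFormula n

record EOMQ (n : ℕ) : Set where
  constructor _,_
  field
    ontology : Ontology
    formula  : EFormula n

𝔊 : Ontology → (𝒜 : DataInstance) → ∀ {n} → EFormula n → Pred (Vec (tem 𝒜) n) _
𝔊 𝒪 𝒜 (ϰ ⟨ x ⟩) 𝔞 = ans (𝒪 , ϰ) 𝒜 (lookup 𝔞 x)
𝔊 𝒪 𝒜 (x ≺ y)   𝔞 = Level.Lift _ (proj₁ (lookup 𝔞 x) < proj₁ (lookup 𝔞 y))
𝔊 𝒪 𝒜 (∼ φ)     𝔞 = ¬ 𝔊 𝒪 𝒜 φ 𝔞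
𝔊 𝒪 𝒜 (φ ∧ ψ)   𝔞 = 𝔊 𝒪 𝒜 φ 𝔞 × 𝔊 𝒪 𝒜 ψ 𝔞
𝔊 𝒪 𝒜 (φ ∨ ψ)   𝔞 = 𝔊 𝒪 𝒜 φ 𝔞 ⊎ 𝔊 𝒪 𝒜 ψ 𝔞
𝔊 𝒪 𝒜 (φ ⇒ ψ)   𝔞 = 𝔊 𝒪 𝒜 φ 𝔞 → 𝔊 𝒪 𝒜 ψ 𝔞
𝔊 𝒪 𝒜 (all′ φ)  𝔞 = ∀ ℓ → 𝔊 𝒪 𝒜 φ (ℓ ∷ 𝔞)
𝔊 𝒪 𝒜 (ex′ φ)   𝔞 = ∃[ ℓ ] 𝔊 𝒪 𝒜 φ (ℓ ∷ 𝔞)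

Answer : ∀ {n} → EOMQ n → (𝒜 : DataInstance) → Pred (Vec (tem 𝒜) n) _
Answer (𝒪 , ψ) 𝒜 = 𝔊 𝒪 𝒜 ψ

concepts : ∀ {n} → EFormula n → List Concept
concepts (ϰ ⟨ x ⟩) = ϰ ∷ []
concepts (x ≺ y)   = []
concepts (∼ φ)     = concepts φ
concepts (φ ∧ ψ)   = concepts φ ++ concepts ψ
concepts (φ ∨ ψ)   = concepts φ ++ concepts ψ
concepts (φ ⇒ ψ)   = concepts φ ++ concepts ψ
concepts (all′ φ)  = concepts φ
concepts (ex′ φ)   = concepts φ

constituents : ∀ {n} → EOMQ n → List OMPIQ
constituents (𝒪 , ψ) = map (𝒪 ,_) (concepts ψ)

data Logic : Set where
  FO⟨<⟩ FO⟨<,≡⟩ FO⟨RPR⟩ : Logic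

data Numerical : Logic → ℕ → Set where
  less : ∀ {n} → Fin n → Fin n → Numerical FO⟨<⟩ n
  fo<  : ∀ {n} → Numerical FO⟨<⟩ n → Numerical FO⟨<,≡⟩ n
  ≡0[mod] : ∀ {n} → Fin n → (m : ℕ) → 1 ℕ.< m → Numerical FO⟨<,≡⟩ n
  succ : ∀ {n} → Fin n → Fin n → Numerical FO⟨RPR⟩ n

-- Formula L Δ n: L-formulas with relation variables of arities Δ and n free
-- individual variables.  Relation variables are bound only by rec, so Δ is
-- irrelevant to FO(<) and FO(<,≡).
data Formula : Logic → List ℕ → ℕ → Set

-- A formula Θᵢ(zᵢ, t, Q₁(z₁, t − 1), …, Qₙ(zₙ, t − 1)), where Q₁, …, Qₙ have
-- arities (without t) in as, and a is the length of zᵢ.  The atoms Qⱼ(zⱼ, t − 1)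
-- are listed separately, and Θ uses them as nullary relation variables.  Hence
-- their arguments are parameters from zᵢ, never variables quantified in Θ.  In
-- Θ, the first individual variable is t and the remaining ones are zᵢ.  No
-- relation variables of enclosing formulas are in scope, as each relation
-- variable occurs in only one recursive definition.
record Definiens (as : List ℕ) (a : ℕ) : Set

data Formula where
  atom    : ∀ {L Δ n} → AtomicConcept → Fin n → Formula L Δ n
  _≐_     : ∀ {L Δ n} → Fin n → Fin n → Formula L Δ n
  num     : ∀ {L Δ n} → Numerical L n → Formula L Δ n
  var     : ∀ {L Δ n a} → a ∈ Δ → Vec (Fin n) a → Formula L Δ n
  ∼_      : ∀ {L Δ n} → Formula L Δ n → Formula L Δ n
  _∧_ _∨_ : ∀ {L Δ n} → Formula L Δ n → Formula L Δ n → Formula L Δ n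
  _⇒_     : ∀ {L Δ n} → Formula L Δ n → Formula L Δ n → Formula L Δ n
  all′    : ∀ {L Δ n} → Formula L Δ (ℕ.suc n) → Formula L Δ n
  ex′     : ∀ {L Δ n} → Formula L Δ (ℕ.suc n) → Formula L Δ n
  rec     : ∀ {Δ n} (as : List ℕ) →
            (∀ {a} → a ∈ as → Definiens as a) →
            Formula FO⟨RPR⟩ (map ℕ.suc as ++ Δ) n →
            Formula FO⟨RPR⟩ Δ n

record Definiens as a where
  inductive
  constructor definiens
  field
    previous : List (∃[ b ] b ∈ as × Vec (Fin a) b)
    Θ        : Formula FO⟨RPR⟩ (map (λ _ → 0) previous) (ℕ.suc a)

module 𝔖 (𝒜 : DataInstance) where

  Relations : List ℕ → Set₁
  Relations = All (λ a → Pred (Vec (tem 𝒜) a) 0ℓ)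

  -- The relations Qᵢ(·, m), where step t computes Qᵢ(·, t) from Qᵢ(·, t − 1)
  -- and Qᵢ(·, − 1) is empty.
  iterate : ∀ {as} → (tem 𝒜 → Relations as → Relations as) →
            ∀ m → + m ≤ max 𝒜 → Relations as
  iterate step ℕ.zero    m≤max = step (0ℤ , +≤+ z≤n , m≤max) (All.universal (λ _ _ → ⊥) _)
  iterate step (ℕ.suc m) m≤max =
    step (+ ℕ.suc m , +≤+ z≤n , m≤max)
         (iterate step m (ℤ.≤-trans (+≤+ (ℕ.n≤1+n m)) m≤max))

  iterateTo : ∀ {as} → (tem 𝒜 → Relations as → Relations as) → tem 𝒜 → Relations as
  iterateTo step (+ m , +≤+ _ , m≤max) = iterate step m m≤max

  ⟦_⟧ⁿ : ∀ {L n} → Numerical L n → Pred (Vec (tem 𝒜) n) 0ℓ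
  ⟦ less x y ⟧ⁿ      𝔞 = proj₁ (lookup 𝔞 x) < proj₁ (lookup 𝔞 y)
  ⟦ fo< α ⟧ⁿ         𝔞 = ⟦ α ⟧ⁿ 𝔞
  ⟦ ≡0[mod] x m _ ⟧ⁿ 𝔞 = + m ∣ proj₁ (lookup 𝔞 x)
  ⟦ succ x y ⟧ⁿ      𝔞 = proj₁ (lookup 𝔞 y) ≡ proj₁ (lookup 𝔞 x) + 1ℤ

  ⟦_⟧ : ∀ {L Δ n} → Formula L Δ n → Relations Δ → Pred (Vec (tem 𝒜) n) 0ℓ

  ⟦_⟧ᵈ : ∀ {as a} → Definiens as a → tem 𝒜 → Relations as → Pred (Vec (tem 𝒜) a) 0ℓ
  ⟦ definiens previous Θ ⟧ᵈ t Q z =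
    ⟦ Θ ⟧ (All.map⁺ (All.tabulate {xs = previous}
            λ { {_ , j , zⱼ} _ [] → All.lookup Q j (Vec.map (lookup z) zⱼ) }))
          (t ∷ z)

  -- The recursion argument t of each Qᵢ comes before zᵢ.
  defined : ∀ {as} → (∀ {a} → a ∈ as → Definiens as a) →
            ∀ {a} → a ∈ as → Pred (Vec (tem 𝒜) (ℕ.suc a)) 0ℓ
  defined Q≡Θ i (t ∷ z) =
    All.lookup (iterateTo (λ t′ Q → All.tabulate λ j → ⟦ Q≡Θ j ⟧ᵈ t′ Q) t) i z

  ⟦ atom A x ⟧     R 𝔞 = (A , proj₁ (lookup 𝔞 x)) ∈ atoms 𝒜
  ⟦ x ≐ y ⟧        R 𝔞 = proj₁ (lookup 𝔞 x) ≡ proj₁ (lookup 𝔞 y)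
  ⟦ num α ⟧        R 𝔞 = ⟦ α ⟧ⁿ 𝔞
  ⟦ var i xs ⟧     R 𝔞 = All.lookup R i (Vec.map (lookup 𝔞) xs)
  ⟦ ∼ φ ⟧          R 𝔞 = ¬ ⟦ φ ⟧ R 𝔞
  ⟦ φ ∧ ψ ⟧        R 𝔞 = ⟦ φ ⟧ R 𝔞 × ⟦ ψ ⟧ R 𝔞
  ⟦ φ ∨ ψ ⟧        R 𝔞 = ⟦ φ ⟧ R 𝔞 ⊎ ⟦ ψ ⟧ R 𝔞
  ⟦ φ ⇒ ψ ⟧        R 𝔞 = ⟦ φ ⟧ R 𝔞 → ⟦ ψ ⟧ R 𝔞
  ⟦ all′ φ ⟧       R 𝔞 = ∀ ℓ → ⟦ φ ⟧ R (ℓ ∷ 𝔞)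
  ⟦ ex′ φ ⟧        R 𝔞 = ∃[ ℓ ] ⟦ φ ⟧ R (ℓ ∷ 𝔞)
  ⟦ rec as Q≡Θ Ψ ⟧ R 𝔞 = ⟦ Ψ ⟧ (All.++⁺ (All.map⁺ (All.tabulate (defined Q≡Θ))) R) 𝔞

infix 4 _,_⊨_

_,_⊨_ : ∀ {L n} (𝒜 : DataInstance) → Vec (tem 𝒜) n → Formula L [] n → Set
𝒜 , 𝔞 ⊨ φ = 𝔖.⟦_⟧ 𝒜 φ [] 𝔞

OMPIQ-Rewritable : Logic → OMPIQ → Set₁
OMPIQ-Rewritable L q =
  ∃[ Q ] ∀ 𝒜 (ℓ : tem 𝒜) → ans q 𝒜 ℓ ⇔ (_,_⊨_ {L} 𝒜 (ℓ ∷ []) Q)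

EOMQ-Rewritable : ∀ {n} → Logic → EOMQ n → Set₁
EOMQ-Rewritable L q =
  ∃[ Q ] ∀ 𝒜 ℓs → Answer q 𝒜 ℓs ⇔ (_,_⊨_ {L} 𝒜 ℓs Q)

{-# OPTIONS --safe #-}
-- The rewriting is obtained by replacing each atom ϰ(x) of ψ with the rewriting
-- of its OMPIQ, its free variable renamed to x: both ψ and its rewriting
-- quantify over tem(𝒜).  The only other case that is not homomorphic is x ≺ y
-- in FO(RPR), where < is the relation Q(z, t) ≡ (t = z + 1) ∨ Q(z, t − 1).
module Submission where

open import Data.Fin.Base using (Fin; zero; suc; lift)
open import Data.Integer.Base using (+_; _<_; +≤+; +<+)
import Data.Integer.Properties as ℤ
open import Data.List.Base using (List; []; _∷_)
open import Data.List.Membership.Propositional using (_∈_)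
open import Data.List.Relation.Unary.All as All using (All; []; _∷_)
import Data.List.Relation.Unary.All.Properties as All
open import Data.List.Relation.Unary.Any using (here)
open import Data.Nat.Base as ℕ using (ℕ)
import Data.Nat.Properties as ℕ
open import Data.Product.Base as Product using (∃; _,_; proj₁)
open import Data.Product.Function.NonDependent.Propositional using (_×-⇔_)
open import Data.Sum.Base using (inj₁; inj₂)
open import Data.Sum.Function.Propositional using (_⊎-⇔_)
open import Data.Vec.Base as Vec using (Vec; []; _∷_; lookup)
import Data.Vec.Properties as Vec
open import Function.Base using (case_of_)
open import Function.Bundles using (_⇔_; mk⇔; module Equivalence)
open import Function.Properties.Equivalence
  using () renaming (refl to ⇔-refl; sym to ⇔-sym; trans to ⇔-trans)
open import Function.Related.Propositional using (≡⇒)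
open import Function.Related.TypeIsomorphisms using (→-cong-⇔; ¬-cong-⇔)
open import Level as Level using (Level)
open import Relation.Binary.PropositionalEquality
  using (_≡_; refl; sym; trans; cong)
open import Defs

open Equivalence using (to; from)

private variable
  a b c : Level
  L : Logic
  Δ : List ℕ
  m n : ℕ

∀-cong-⇔ : {A : Set a} {B : A → Set b} {C : A → Set c} →
           (∀ x → B x ⇔ C x) → (∀ x → B x) ⇔ (∀ x → C x)
∀-cong-⇔ B⇔C = mk⇔ (λ f x → to (B⇔C x) (f x)) (λ f x → from (B⇔C x) (f x))

∃-cong-⇔ : {A : Set a} {B : A → Set b} {C : A → Set c} →
           (∀ x → B x ⇔ C x) → ∃ B ⇔ ∃ C
∃-cong-⇔ B⇔C = mk⇔ (Product.map₂ (to (B⇔C _))) (Product.map₂ (from (B⇔C _)))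

renameⁿ : (Fin m → Fin n) → Numerical L m → Numerical L n
renameⁿ ρ (less x y)         = less (ρ x) (ρ y)
renameⁿ ρ (fo< α)            = fo< (renameⁿ ρ α)
renameⁿ ρ (≡0[mod] x k 1<k) = ≡0[mod] (ρ x) k 1<k
renameⁿ ρ (succ x y)         = succ (ρ x) (ρ y)

rename : (Fin m → Fin n) → Formula L Δ m → Formula L Δ n
rename ρ (atom A x)      = atom A (ρ x)
rename ρ (x ≐ y)         = ρ x ≐ ρ y
rename ρ (num α)         = num (renameⁿ ρ α)
rename ρ (var i xs)      = var i (Vec.map ρ xs)
rename ρ (∼ φ)           = ∼ rename ρ φ
rename ρ (φ ∧ ψ)         = rename ρ φ ∧ rename ρ ψ
rename ρ (φ ∨ ψ)         = rename ρ φ ∨ rename ρ ψ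
rename ρ (φ ⇒ ψ)         = rename ρ φ ⇒ rename ρ ψ
rename ρ (all′ φ)        = all′ (rename (lift 1 ρ) φ)
rename ρ (ex′ φ)         = ex′ (rename (lift 1 ρ) φ)
-- The only individual variables of a definiens are `t` and its own parameters, so `ρ` leaves the
-- definientia alone.
rename ρ (rec as Q≡Θ Ψ) = rec as Q≡Θ (rename ρ Ψ)

lookup-lift : {A : Set a} (ρ : Fin m → Fin n) (xs : Vec A m) (ys : Vec A n) →
               (∀ x → lookup ys (ρ x) ≡ lookup xs x) →
               ∀ z x → lookup (z ∷ ys) (lift 1 ρ x) ≡ lookup (z ∷ xs) x
lookup-lift ρ xs ys eq z zero    = refl
lookup-lift ρ xs ys eq z (suc x) = eq x

module _ (𝒜 : DataInstance) where
  open 𝔖 𝒜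

  ⟦renameⁿ⟧ : (ρ : Fin m → Fin n) (𝔞 : Vec (tem 𝒜) m) (𝔟 : Vec (tem 𝒜) n) →
              (∀ x → lookup 𝔟 (ρ x) ≡ lookup 𝔞 x) →
              (α : Numerical L m) → ⟦ renameⁿ ρ α ⟧ⁿ 𝔟 ≡ ⟦ α ⟧ⁿ 𝔞
  ⟦renameⁿ⟧ ρ 𝔞 𝔟 eq (less x y)      rewrite eq x | eq y = refl
  ⟦renameⁿ⟧ ρ 𝔞 𝔟 eq (fo< α)         = ⟦renameⁿ⟧ ρ 𝔞 𝔟 eq α
  ⟦renameⁿ⟧ ρ 𝔞 𝔟 eq (≡0[mod] x k _) rewrite eq x = refl
  ⟦renameⁿ⟧ ρ 𝔞 𝔟 eq (succ x y)      rewrite eq x | eq y = refl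

  -- Linking `𝔞` and `𝔟` by a pointwise hypothesis lets it pass under a quantifier via
  -- `lookup-lift`. The conclusion is `⇔` because equality of quantified types would require
  -- function extensionality.
  ⟦rename⟧ : (ρ : Fin m → Fin n) (𝔞 : Vec (tem 𝒜) m) (𝔟 : Vec (tem 𝒜) n) →
             (∀ x → lookup 𝔟 (ρ x) ≡ lookup 𝔞 x) →
             (φ : Formula L Δ m) (R : Relations Δ) → ⟦ rename ρ φ ⟧ R 𝔟 ⇔ ⟦ φ ⟧ R 𝔞
  ⟦rename⟧ ρ 𝔞 𝔟 eq (atom A x)  R rewrite eq x = ⇔-refl
  ⟦rename⟧ ρ 𝔞 𝔟 eq (x ≐ y)     R rewrite eq x | eq y = ⇔-refl
  ⟦rename⟧ ρ 𝔞 𝔟 eq (num α)     R = ≡⇒ (⟦renameⁿ⟧ ρ 𝔞 𝔟 eq α)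
  ⟦rename⟧ ρ 𝔞 𝔟 eq (var i xs)  R = ≡⇒ (cong (All.lookup R i)
    (trans (sym (Vec.map-∘ (lookup 𝔟) ρ xs)) (Vec.map-cong eq xs)))
  ⟦rename⟧ ρ 𝔞 𝔟 eq (∼ φ)       R = ¬-cong-⇔ (⟦rename⟧ ρ 𝔞 𝔟 eq φ R)
  ⟦rename⟧ ρ 𝔞 𝔟 eq (φ ∧ ψ)     R = ⟦rename⟧ ρ 𝔞 𝔟 eq φ R ×-⇔ ⟦rename⟧ ρ 𝔞 𝔟 eq ψ R
  ⟦rename⟧ ρ 𝔞 𝔟 eq (φ ∨ ψ)     R = ⟦rename⟧ ρ 𝔞 𝔟 eq φ R ⊎-⇔ ⟦rename⟧ ρ 𝔞 𝔟 eq ψ R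
  ⟦rename⟧ ρ 𝔞 𝔟 eq (φ ⇒ ψ)     R = →-cong-⇔ (⟦rename⟧ ρ 𝔞 𝔟 eq φ R) (⟦rename⟧ ρ 𝔞 𝔟 eq ψ R)
  ⟦rename⟧ ρ 𝔞 𝔟 eq (all′ φ)    R = ∀-cong-⇔ λ ℓ →
    ⟦rename⟧ (lift 1 ρ) (ℓ ∷ 𝔞) (ℓ ∷ 𝔟) (lookup-lift ρ 𝔞 𝔟 eq ℓ) φ R
  ⟦rename⟧ ρ 𝔞 𝔟 eq (ex′ φ)     R = ∃-cong-⇔ λ ℓ →
    ⟦rename⟧ (lift 1 ρ) (ℓ ∷ 𝔞) (ℓ ∷ 𝔟) (lookup-lift ρ 𝔞 𝔟 eq ℓ) φ R
  -- The relations defined by `Q≡Θ` depend on no assignment, so both sides extend `R` in the same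
  -- way.
  ⟦rename⟧ ρ 𝔞 𝔟 eq (rec as Q≡Θ Ψ) R = ⟦rename⟧ ρ 𝔞 𝔟 eq Ψ _

lessDefiniens : ∀ {a} → a ∈ 1 ∷ [] → Definiens (1 ∷ []) a
lessDefiniens (here refl) =
  -- In the listed atom Q(z, t - 1), `zero` is z, since t is not a parameter there; in Θ, `zero` is
  -- t and `suc zero` is z.
  definiens ((1 , here refl , zero ∷ []) ∷ [])
            (num (succ (suc zero) zero) ∨ var (here refl) [])

lessFormula : (L : Logic) → Fin n → Fin n → Formula L [] n
lessFormula FO⟨<⟩   x y = num (less x y)
lessFormula FO⟨<,≡⟩ x y = num (fo< (less x y))
-- The recursion argument comes first: t is `y` and z is `x`.
lessFormula FO⟨RPR⟩ x y = rec (1 ∷ []) lessDefiniens (var (here refl) (y ∷ x ∷ []))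

module _ (𝒜 : DataInstance) where
  open 𝔖 𝒜

  -- Induction on time: Q(s, ·) becomes true at s + 1 through the successor disjunct and then
  -- persists through the recursive one.
  iterate-less : ∀ k k≤max (s : tem 𝒜) →
    All.lookup (iterate (λ t Q → All.tabulate λ j → ⟦ lessDefiniens j ⟧ᵈ t Q) k k≤max)
      (here refl) (s ∷ []) ⇔ proj₁ s < + k
  -- At time 0 both sides fail: Q(s, -1) is empty, and s ≥ 0 rules out 0 = s + 1 as well as s < 0.
  iterate-less ℕ.zero k≤max (+ i , _) = mk⇔ (λ where
    (inj₁ 0≡i+1) → case trans (ℤ.+-injective 0≡i+1) (ℕ.+-comm i 1) of λ ()) λ where
    (+<+ ())
  iterate-less (ℕ.suc k) k≤max s@(+ i , _) = mk⇔ (λ where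
    (inj₁ k+1≡i+1) → +<+ (ℕ.≤-reflexive (sym (trans (ℤ.+-injective k+1≡i+1) (ℕ.+-comm i 1))))
    (inj₂ i<k)      → ℤ.<-trans (to (iterate-less k _ s) i<k) (+<+ ℕ.≤-refl)) λ where
    -- Either s lies before the previous time k and Q already held there, or s = k and Q starts to
    -- hold now.
    (+<+ i<k+1) → case ℕ.m<1+n⇒m<n∨m≡n i<k+1 of λ where
      (inj₁ i<k)  → inj₂ (from (iterate-less k _ s) (+<+ i<k))
      (inj₂ refl) → inj₁ (cong +_ (ℕ.+-comm 1 i))

  ⟦lessFormula⟧ : ∀ L (x y : Fin n) (𝔞 : Vec (tem 𝒜) n) →
                  𝒜 , 𝔞 ⊨ lessFormula L x y ⇔ proj₁ (lookup 𝔞 x) < proj₁ (lookup 𝔞 y)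
  ⟦lessFormula⟧ FO⟨<⟩   x y 𝔞 = ⇔-refl
  ⟦lessFormula⟧ FO⟨<,≡⟩ x y 𝔞 = ⇔-refl
  -- `iterateTo` reduces only once the time is exposed as a natural number with its bounds.
  ⟦lessFormula⟧ FO⟨RPR⟩ x y 𝔞 with lookup 𝔞 y
  ... | + k , +≤+ _ , k≤max = iterate-less k k≤max (lookup 𝔞 x)

module _ (L : Logic) (𝒪 : Ontology) where

  -- With `𝒪` fixed, indexing by `concepts ψ` makes the hypothesis split along `_++_` in the
  -- induction on ψ.
  Rewritings : EFormula n → Set₁
  Rewritings ψ = All (λ ϰ → OMPIQ-Rewritable L (𝒪 , ϰ)) (concepts ψ)

  rewriting : (ψ : EFormula n) → Rewritings ψ → EOMQ-Rewritable L (𝒪 , ψ)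
  rewriting (ϰ ⟨ x ⟩) ((Q , ans⇔Q) ∷ []) = rename (λ _ → x) Q , λ 𝒜 𝔞 →
    ⇔-trans (ans⇔Q 𝒜 (lookup 𝔞 x))
            (⇔-sym (⟦rename⟧ 𝒜 (λ _ → x) (lookup 𝔞 x ∷ []) 𝔞 (λ { zero → refl }) Q []))
  rewriting (x ≺ y) [] = lessFormula L x y , λ 𝒜 𝔞 →
    -- The lift is there because `ans` quantifies over all interpretations, which puts `𝔊` one
    -- universe higher.
    ⇔-trans (mk⇔ Level.lower Level.lift) (⇔-sym (⟦lessFormula⟧ 𝒜 L x y 𝔞))
  rewriting (∼ φ) rs =
    let P , eqP = rewriting φ rs in
    ∼ P , λ 𝒜 𝔞 → ¬-cong-⇔ (eqP 𝒜 𝔞)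
  rewriting (φ ∧ ψ) rs =
    let P , eqP = rewriting φ (All.++⁻ˡ (concepts φ) rs)
        Q , eqQ = rewriting ψ (All.++⁻ʳ (concepts φ) rs) in
    P ∧ Q , λ 𝒜 𝔞 → eqP 𝒜 𝔞 ×-⇔ eqQ 𝒜 𝔞
  rewriting (φ ∨ ψ) rs =
    let P , eqP = rewriting φ (All.++⁻ˡ (concepts φ) rs)
        Q , eqQ = rewriting ψ (All.++⁻ʳ (concepts φ) rs) in
    P ∨ Q , λ 𝒜 𝔞 → eqP 𝒜 𝔞 ⊎-⇔ eqQ 𝒜 𝔞
  rewriting (φ ⇒ ψ) rs =
    let P , eqP = rewriting φ (All.++⁻ˡ (concepts φ) rs)
        Q , eqQ = rewriting ψ (All.++⁻ʳ (concepts φ) rs) in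
    P ⇒ Q , λ 𝒜 𝔞 → →-cong-⇔ (eqP 𝒜 𝔞) (eqQ 𝒜 𝔞)
  rewriting (all′ φ) rs =
    let P , eqP = rewriting φ rs in
    all′ P , λ 𝒜 𝔞 → ∀-cong-⇔ λ ℓ → eqP 𝒜 (ℓ ∷ 𝔞)
  rewriting (ex′ φ) rs =
    let P , eqP = rewriting φ rs in
    ex′ P , λ 𝒜 𝔞 → ∃-cong-⇔ λ ℓ → eqP 𝒜 (ℓ ∷ 𝔞)

theorem33 : (L : Logic) (n : ℕ) (q : EOMQ n) →
    All (OMPIQ-Rewritable L) (constituents q) →
    EOMQ-Rewritable L q
theorem33 L n (𝒪 , ψ) rs = rewriting L 𝒪 ψ (All.map⁻ rs)
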